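{- Let $(A_n)_{n\ge1}$ be the first of the four sequences $A,B,C,D$ associated with the anti-Tribonacci sequence $(D_n)$. Then for all $n\ge 1$, $$A_{n+4}+A_n=A_{n+3}+A_{n+1}.$$
   Context: For a set $S$ of positive integers, $\mathrm{mex}(S)$ denotes the smallest positive integer not in $S$. The sequences are defined recursively as follows: $A_1=1$, $B_1=2$, $C_1=3$, $D_1=6$, and for $n\ge 1$, with $S_n=\{A_i,B_i,C_i,D_i: 1\le i\le n\}$, one sets $A_{n+1}=\mathrm{mex}(S_n)$, $B_{n+1}=\mathrm{mex}(S_n\cup\{A_{n+1}\})$, $C_{n+1}=\mathrm{mex}(S_n\cup\{A_{n+1},B_{n+1}\})$, and $D_{n+1}=A_{n+1}+B_{n+1}+C_{n+1}$. The $D_n$ are the anti-Tribonacci numbers $6,16,27,36,46,57,66,75,87,96,\ldots$ (OEIS A265389). -}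

module Defs where

open import Data.List.Base using (List; []; _∷_)
open import Data.List.Membership.DecPropositional using (_∈?_)
open import Data.List.Membership.Propositional using (_∈_; _∉_)
open import Data.List.Relation.Unary.Any using (here; there)
open import Data.Nat.Base
open import Data.Nat.ListAction using (sum)
open import Data.Nat.Properties
open import Data.Product.Base using (_×_; _,_)
open import Relation.Binary.PropositionalEquality using (refl; subst)
open import Relation.Nullary using (yes; no)

-- Finite sets of positive integers are represented by lists of naturals.

IsMex : List ℕ → ℕ → Set
IsMex xs m = NonZero m × m ∉ xs × (∀ k → NonZero k → k ∉ xs → m ≤ k)

-- mexFrom f k xs is the first of k, k + 1, …, k + f missing from xs, where
-- k + f is returned without being tested.
mexFrom : ℕ → ℕ → List ℕ → ℕ
mexFrom zero    k xs = k
mexFrom (suc f) k xs with _∈?_ _≟_ k xs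
... | yes _ = mexFrom f (suc k) xs
... | no  _ = k

-- The search may stop at 1 + sum xs, which exceeds every element of xs.
mex : List ℕ → ℕ
mex xs = mexFrom (sum xs) 1 xs

private
  ∈⇒≤sum : ∀ {x} xs → x ∈ xs → x ≤ sum xs
  ∈⇒≤sum (y ∷ ys) (here refl) = m≤m+n y (sum ys)
  ∈⇒≤sum (y ∷ ys) (there p)   = ≤-trans (∈⇒≤sum ys p) (m≤n+m (sum ys) y)

  mexFrom-isMex : ∀ f k xs → NonZero k → k + f ∉ xs →
                  (∀ j → NonZero j → j ∉ xs → k ≤ j) → IsMex xs (mexFrom f k xs)
  mexFrom-isMex zero    k xs k≢0 k+f∉ min = k≢0 , subst (_∉ xs) (+-identityʳ k) k+f∉ , min
  mexFrom-isMex (suc f) k xs k≢0 k+f∉ min with _∈?_ _≟_ k xs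
  ... | no  k∉ = k≢0 , k∉ , min
  ... | yes k∈ = mexFrom-isMex f (suc k) xs _ (subst (_∉ xs) (+-suc k f) k+f∉)
                   λ j j≢0 j∉ → ≤∧≢⇒< (min j j≢0 j∉) λ k≡j → j∉ (subst (_∈ xs) k≡j k∈)

mex-isMex : ∀ xs → IsMex xs (mex xs)
mex-isMex xs = mexFrom-isMex (sum xs) 1 xs _ (λ p → 1+n≰n (∈⇒≤sum xs p))
                 λ j j≢0 _ → >-nonZero⁻¹ j {{j≢0}}

-- The sequences are indexed from 1; index 0 is excluded by NonZero.
A B C D : (n : ℕ) → .{{NonZero n}} → ℕ
S : (n : ℕ) → .{{NonZero n}} → List ℕ

A 1             = 1
A (suc (suc n)) = mex (S (suc n))

B 1             = 2
B (suc (suc n)) = mex (A (suc (suc n)) ∷ S (suc n))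

C 1             = 3
C (suc (suc n)) = mex (A (suc (suc n)) ∷ B (suc (suc n)) ∷ S (suc n))

D 1             = 6
D (suc (suc n)) = A (suc (suc n)) + B (suc (suc n)) + C (suc (suc n))

S 1             = A 1 ∷ B 1 ∷ C 1 ∷ D 1 ∷ []
S (suc (suc n)) = A (suc (suc n)) ∷ B (suc (suc n)) ∷ C (suc (suc n)) ∷ D (suc (suc n)) ∷ S (suc n)

{-# OPTIONS --safe #-}

-- Cut the positive integers into the blocks 10k + 1, …, 10k + 10.  By induction
-- on k, the k-th block contains exactly one anti-Tribonacci number, namely
-- D (k + 1) = 10k + o with o ∈ {5, 6, 7}, and its nine other elements are,
-- in increasing order, the triples of indices 3k + 1, 3k + 2 and 3k + 3.  These
-- triples start at 10k + 1, 10k + 4 and 10k + 8 whatever o is, which gives A;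
-- their sums are 10(3k) + 6, 10(3k + 1) + (12 - o) and 10(3k + 2) + 7, so the
-- offsets of the next anti-Tribonacci numbers are again in {5, 6, 7}.
module Submission where

open import Defs
open import Data.Nat.Base using (ℕ; _+_; NonZero)
open import Relation.Binary.PropositionalEquality using (_≡_)

open import Data.Fin.Base using (zero; suc)
open import Data.List.Base using (List; []; _∷_)
open import Data.List.Membership.Propositional using (_∈_; _∉_)
open import Data.List.Relation.Binary.Permutation.Propositional
  using (_↭_; ↭-refl; ↭-trans; prep; swap; ↭-sym)
open import Data.List.Relation.Binary.Permutation.Propositional.Properties using (∈-resp-↭)
open import Data.List.Relation.Unary.Any using (here; there)
open import Data.Nat.Base using (zero; suc; _*_; _<_; s≤s)
open import Data.Nat.DivMod using (_divMod_; result; _%_; [m+kn]%n≡m%n; m<n⇒m%n≡m)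
open import Data.Nat.Properties
open import Data.Nat.Tactic.RingSolver using (solve-∀)
open import Data.Product.Base using (_×_; _,_; proj₁; proj₂; ∃-syntax)
open import Data.Sum.Base using (_⊎_; inj₁; inj₂)
open import Function.Base using (_∘_)
open import Function.Bundles using (_⇔_; mk⇔; Equivalence)
open import Relation.Binary.PropositionalEquality
  using (refl; sym; trans; cong; cong₂; subst; _≢_)
open import Relation.Nullary using (¬_)
open import Relation.Nullary.Decidable using (from-yes)

open Equivalence using (to; from)

-- Mex of an initial segment enlarged by a set of exceptions

Fills : List ℕ → ℕ → List ℕ → Set
Fills ds m xs = ∀ {x} → NonZero x → x ∈ xs ⇔ (x < m ⊎ x ∈ ds)

Fills-resp-↭ : ∀ {ds m xs ys} → xs ↭ ys → Fills ds m xs → Fills ds m ys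
Fills-resp-↭ p f x≢0 = mk⇔ (to (f x≢0) ∘ ∈-resp-↭ (↭-sym p)) (∈-resp-↭ p ∘ from (f x≢0))

Fills-insert : ∀ {ds m xs} → Fills ds m xs → Fills ds (suc m) (m ∷ xs)
Fills-insert {ds} {m} {xs} f {x} x≢0 = mk⇔ fwd bwd
  where
  fwd : x ∈ m ∷ xs → x < suc m ⊎ x ∈ ds
  fwd (here refl) = inj₁ ≤-refl
  fwd (there p) with to (f x≢0) p
  ... | inj₁ x<m = inj₁ (m<n⇒m<1+n x<m)
  ... | inj₂ x∈ds = inj₂ x∈ds
  bwd : x < suc m ⊎ x ∈ ds → x ∈ m ∷ xs
  bwd (inj₂ x∈ds) = there (from (f x≢0) (inj₂ x∈ds))
  bwd (inj₁ (s≤s x≤m)) with m≤n⇒m<n∨m≡n x≤m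
  ... | inj₁ x<m = there (from (f x≢0) (inj₁ x<m))
  ... | inj₂ x≡m = here x≡m

Fills-skip : ∀ {ds m xs} → m ∈ ds → Fills ds m xs → Fills ds (suc m) xs
Fills-skip {ds} {m} {xs} m∈ds f {x} x≢0 = mk⇔ fwd bwd
  where
  fwd : x ∈ xs → x < suc m ⊎ x ∈ ds
  fwd p with to (f x≢0) p
  ... | inj₁ x<m = inj₁ (m<n⇒m<1+n x<m)
  ... | inj₂ x∈ds = inj₂ x∈ds
  bwd : x < suc m ⊎ x ∈ ds → x ∈ xs
  bwd (inj₂ x∈ds) = from (f x≢0) (inj₂ x∈ds)
  bwd (inj₁ (s≤s x≤m)) with m≤n⇒m<n∨m≡n x≤m
  ... | inj₁ x<m  = from (f x≢0) (inj₁ x<m)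
  ... | inj₂ refl = from (f x≢0) (inj₂ m∈ds)

Fills-∷ : ∀ {ds m xs} d → Fills ds m xs → Fills (d ∷ ds) m (d ∷ xs)
Fills-∷ {ds} {m} {xs} d f {x} x≢0 = mk⇔ fwd bwd
  where
  fwd : x ∈ d ∷ xs → x < m ⊎ x ∈ d ∷ ds
  fwd (here x≡d) = inj₂ (here x≡d)
  fwd (there p) with to (f x≢0) p
  ... | inj₁ x<m = inj₁ x<m
  ... | inj₂ x∈ds = inj₂ (there x∈ds)
  bwd : x < m ⊎ x ∈ d ∷ ds → x ∈ d ∷ xs
  bwd (inj₁ x<m)          = there (from (f x≢0) (inj₁ x<m))
  bwd (inj₂ (here x≡d))   = here x≡d
  bwd (inj₂ (there x∈ds)) = there (from (f x≢0) (inj₂ x∈ds))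

-- Nothing below `suc m` is missing, and `suc m` itself could only have entered through `ds`.
Fills⇒mex : ∀ {ds m xs} → Fills ds (suc m) xs → suc m ∉ ds → mex xs ≡ suc m
Fills⇒mex {ds} {m} {xs} f m∉ds with mex-isMex xs
... | mex≢0 , mex∉xs , min =
  ≤-antisym (min (suc m) _ m∉xs) (≮⇒≥ (mex∉xs ∘ from (f mex≢0) ∘ inj₁))
  where
  m∉xs : suc m ∉ xs
  m∉xs p with to (f _) p
  ... | inj₁ m<m  = <-irrefl refl m<m
  ... | inj₂ m∈ds = m∉ds m∈ds

-- A trace of the mex search: every `skip` passes an exception already in the set, so `Fills-next`
-- can raise the bound there without inserting anything.
data Next (ds : List ℕ) : ℕ → ℕ → Set where
  stop : ∀ {m} → m ∉ ds → Next ds m m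
  skip : ∀ {m a} → m ∈ ds → Next ds (suc m) a → Next ds m a

Fills-next : ∀ {ds m a xs} → Fills ds (suc m) xs → Next ds (suc m) a →
             mex xs ≡ a × Fills ds (suc a) (mex xs ∷ xs)
Fills-next {ds} {m} {xs = xs} f (stop m∉ds) =
  eq , subst (λ y → Fills ds (suc (suc m)) (y ∷ xs)) (sym eq) (Fills-insert f)
  where eq = Fills⇒mex f m∉ds
Fills-next f (skip m∈ds nx) = Fills-next (Fills-skip m∈ds f) nx

-- One step of the recursion

S₀ : ℕ → List ℕ
S₀ zero    = []
S₀ (suc n) = S (suc n)

Ds : ℕ → List ℕ
Ds zero    = []
Ds (suc n) = D (suc n) ∷ Ds n

-- The prescribed values 1, 2, 3 and 6 are those that the recursion yields from the empty set, so
-- the induction needs no special first block.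
A≡mex : ∀ n → A (suc n) ≡ mex (S₀ n)
A≡mex zero    = refl
A≡mex (suc n) = refl

B≡mex : ∀ n → B (suc n) ≡ mex (A (suc n) ∷ S₀ n)
B≡mex zero    = refl
B≡mex (suc n) = refl

C≡mex : ∀ n → C (suc n) ≡ mex (A (suc n) ∷ B (suc n) ∷ S₀ n)
C≡mex zero    = refl
C≡mex (suc n) = refl

D≡A+B+C : ∀ n → D (suc n) ≡ A (suc n) + B (suc n) + C (suc n)
D≡A+B+C zero    = refl
D≡A+B+C (suc n) = refl

S₀-suc : ∀ n → S₀ (suc n) ≡ A (suc n) ∷ B (suc n) ∷ C (suc n) ∷ D (suc n) ∷ S₀ n
S₀-suc zero    = refl
S₀-suc (suc n) = refl

-- Three mex searches, each resumed just above the previous value; `Fills-∷` then adds the new `D`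
-- both to the set and to the exceptions.
Fills-step : ∀ n {m a b c} → Fills (Ds n) (suc m) (S₀ n) →
             Next (Ds n) (suc m) a → Next (Ds n) (suc a) b → Next (Ds n) (suc b) c →
             A (suc n) ≡ a × D (suc n) ≡ a + b + c × Fills (Ds (suc n)) (suc c) (S₀ (suc n))
Fills-step n {m} {a} {b} {c} f nxA nxB nxC =
  A≡a ,
  trans (D≡A+B+C n) (cong₂ _+_ (cong₂ _+_ A≡a B≡b) C≡c) ,
  subst (Fills _ _) (sym (S₀-suc n)) (Fills-resp-↭ reorder (Fills-∷ (D (suc n)) fC))
  where
  -- `A (suc n)` unfolds to a mex only after `n` is split, so the equation is taken for a variable
  -- `v`, where it can be matched.
  next : ∀ {m a v xs} → v ≡ mex xs → Fills (Ds n) (suc m) xs → Next (Ds n) (suc m) a →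
         v ≡ a × Fills (Ds n) (suc a) (v ∷ xs)
  next refl = Fills-next

  stepA = next (A≡mex n) f nxA
  A≡a = proj₁ stepA
  stepB = next (B≡mex n) (proj₂ stepA) nxB
  B≡b = proj₁ stepB
  stepC = next (C≡mex n) (Fills-resp-↭ (swap _ _ ↭-refl) (proj₂ stepB)) nxC
  C≡c = proj₁ stepC
  fC = proj₂ stepC

  reorder : D (suc n) ∷ C (suc n) ∷ A (suc n) ∷ B (suc n) ∷ S₀ n ↭
            A (suc n) ∷ B (suc n) ∷ C (suc n) ∷ D (suc n) ∷ S₀ n
  reorder = ↭-trans (swap _ _ ↭-refl)
           (↭-trans (prep _ (swap _ _ ↭-refl))
           (↭-trans (swap _ _ (swap _ _ ↭-refl))
                    (prep _ (swap _ _ ↭-refl))))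

-- Anti-Tribonacci numbers within blocks of ten

data Offset : ℕ → Set where
  five  : Offset 5
  six   : Offset 6
  seven : Offset 7

offset<10 : ∀ {o} → Offset o → o < 10
offset<10 five  = from-yes (5 <? 10)
offset<10 six   = from-yes (6 <? 10)
offset<10 seven = from-yes (7 <? 10)

Located : ℕ → Set
Located n = ∀ {j} → j < n → ∃[ o ] Offset o × D (suc j) ≡ o + j * 10

Located-suc : ∀ {n o} → Offset o → D (suc n) ≡ o + n * 10 → Located n → Located (suc n)
Located-suc off eq loc (s≤s j≤n) with m≤n⇒m<n∨m≡n j≤n
... | inj₁ j<n  = loc j<n
... | inj₂ refl = _ , off , eq

∈Ds⁻ : ∀ {x} n → x ∈ Ds n → ∃[ j ] j < n × x ≡ D (suc j)
∈Ds⁻ (suc n) (here x≡d) = n , ≤-refl , x≡d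
∈Ds⁻ (suc n) (there p) with ∈Ds⁻ n p
... | j , j<n , x≡d = j , m<n⇒m<1+n j<n , x≡d

∈Ds⁺ : ∀ {j n} → j < n → D (suc j) ∈ Ds n
∈Ds⁺ {j} {suc n} (s≤s j≤n) with m≤n⇒m<n∨m≡n j≤n
... | inj₁ j<n  = there (∈Ds⁺ j<n)
... | inj₂ refl = here refl

digits-injective : ∀ {r s j k} → r < 10 → s < 10 → r + k * 10 ≡ s + j * 10 → r ≡ s × k ≡ j
digits-injective {r} {s} {j} {k} r<10 s<10 eq = r≡s , k≡j
  where
  r≡s : r ≡ s
  r≡s = trans (sym (trans ([m+kn]%n≡m%n r k 10) (m<n⇒m%n≡m r<10)))
       (trans (cong (_% 10) eq) (trans ([m+kn]%n≡m%n s j 10) (m<n⇒m%n≡m s<10)))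
  k≡j : k ≡ j
  k≡j = *-cancelʳ-≡ k j 10 (+-cancelˡ-≡ r _ _ (trans eq (cong (_+ j * 10) (sym r≡s))))

-- Each `D (suc j)` has its own block `j` and a digit below 10, so uniqueness of the decomposition
-- forces `j` to be `k`.
∈Ds-digits : ∀ {n r} k → Located n → r < 10 → r + k * 10 ∈ Ds n →
             Offset r × D (suc k) ≡ r + k * 10
∈Ds-digits {n} k loc r<10 p with ∈Ds⁻ n p
... | j , j<n , x≡d with loc j<n
... | o , off , d≡ with digits-injective {j = j} {k} r<10 (offset<10 off) (trans x≡d d≡)
... | refl , refl = off , d≡

∉Ds-nonOffset : ∀ {n r} k → Located n → r < 10 → ¬ Offset r → r + k * 10 ∉ Ds n
∉Ds-nonOffset k loc r<10 ¬off = ¬off ∘ proj₁ ∘ ∈Ds-digits k loc r<10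

∉Ds-otherOffset : ∀ {n r o} k → Located n → r < 10 → D (suc k) ≡ o + k * 10 → r ≢ o →
                  r + k * 10 ∉ Ds n
∉Ds-otherOffset {r = r} {o} k loc r<10 eq r≢o p =
  r≢o (+-cancelʳ-≡ (k * 10) r o (trans (sym (proj₂ (∈Ds-digits k loc r<10 p))) eq))

∈Ds-offset : ∀ {k n o} → k < n → D (suc k) ≡ o + k * 10 → o + k * 10 ∈ Ds n
∈Ds-offset {n = n} k<n eq = subst (_∈ Ds n) eq (∈Ds⁺ k<n)

-- The middle triple of a block

record MiddleTriple (k n : ℕ) : Set where
  field
    {b c o′} : ℕ
    nextB  : Next (Ds n) (5 + k * 10) b
    nextC  : Next (Ds n) (suc b) c
    -- The third triple is searched after a further `D` has joined the exceptions, hence the general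
    -- `n′`.
    nextA  : ∀ {n′} → Located n′ → k < n′ → Next (Ds n′) (suc c) (8 + k * 10)
    offset : Offset o′
    sum≡   : (4 + k * 10) + b + c ≡ o′ + (1 + k * 3) * 10

∉8 : ∀ {n} k → Located n → 8 + k * 10 ∉ Ds n
∉8 k loc = ∉Ds-nonOffset k loc (from-yes (8 <? 10)) λ ()

-- The triple consists of 4 and the two digits among 5, 6, 7 that `D (suc k)` leaves free. The
-- search skips `D (suc k)` before `b`, before `c` or before the third triple accordingly.
middleTriple : ∀ {k n} → Located n → k < n → MiddleTriple k n
middleTriple {k} {n} loc k<n with loc k<n
... | _ , five , eq = record
  { nextB  = skip (∈Ds-offset k<n eq)
               (stop (∉Ds-otherOffset k loc (offset<10 six) eq λ ()))
  ; nextC  = stop (∉Ds-otherOffset k loc (offset<10 seven) eq λ ())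
  ; nextA  = λ loc′ _ → stop (∉8 k loc′)
  ; offset = seven
  ; sum≡   = sum17 k
  }
  where
  sum17 : ∀ k → (4 + k * 10) + (6 + k * 10) + (7 + k * 10) ≡ 7 + (1 + k * 3) * 10
  sum17 = solve-∀
... | _ , six , eq = record
  { nextB  = stop (∉Ds-otherOffset k loc (offset<10 five) eq λ ())
  ; nextC  = skip (∈Ds-offset k<n eq)
               (stop (∉Ds-otherOffset k loc (offset<10 seven) eq λ ()))
  ; nextA  = λ loc′ _ → stop (∉8 k loc′)
  ; offset = six
  ; sum≡   = sum16 k
  }
  where
  sum16 : ∀ k → (4 + k * 10) + (5 + k * 10) + (7 + k * 10) ≡ 6 + (1 + k * 3) * 10
  sum16 = solve-∀
... | _ , seven , eq = record
  { nextB  = stop (∉Ds-otherOffset k loc (offset<10 five) eq λ ())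
  ; nextC  = stop (∉Ds-otherOffset k loc (offset<10 six) eq λ ())
  ; nextA  = λ loc′ k<n′ → skip (∈Ds-offset k<n′ eq) (stop (∉8 k loc′))
  ; offset = five
  ; sum≡   = sum15 k
  }
  where
  sum15 : ∀ k → (4 + k * 10) + (5 + k * 10) + (6 + k * 10) ≡ 5 + (1 + k * 3) * 10
  sum15 = solve-∀

-- Induction on blocks

record BlockStart (k : ℕ) : Set where
  field
    located : Located (k * 3)
    fills   : Fills (Ds (k * 3)) (1 + k * 10) (S₀ (k * 3))

record BlockA (k : ℕ) : Set where
  field
    A₁ : A (1 + k * 3) ≡ 1 + k * 10
    A₂ : A (2 + k * 3) ≡ 4 + k * 10
    A₃ : A (3 + k * 3) ≡ 8 + k * 10

block-step : ∀ k → BlockStart k → BlockA k × BlockStart (suc k)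
block-step k start =
  record { A₁ = proj₁ step₁ ; A₂ = proj₁ step₂ ; A₃ = proj₁ step₃ } ,
  record { located = loc₃ ; fills = proj₂ (proj₂ step₃) }
  where
  open BlockStart start renaming (located to loc₀; fills to fills₀)

  n = k * 3

  free : ∀ {n} r → Located n → r < 10 → ¬ Offset r → Next (Ds n) (r + k * 10) (r + k * 10)
  free r loc r<10 ¬off = stop (∉Ds-nonOffset k loc r<10 ¬off)

  sum6 : ∀ k → (1 + k * 10) + (2 + k * 10) + (3 + k * 10) ≡ 6 + k * 3 * 10
  sum6 = solve-∀

  sum27 : ∀ k → (8 + k * 10) + (9 + k * 10) + (10 + k * 10) ≡ 7 + (2 + k * 3) * 10
  sum27 = solve-∀

  step₁ = Fills-step n fills₀
            (free 1 loc₀ (from-yes (1 <? 10)) λ ())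
            (free 2 loc₀ (from-yes (2 <? 10)) λ ())
            (free 3 loc₀ (from-yes (3 <? 10)) λ ())
  loc₁ : Located (1 + n)
  loc₁ = Located-suc six (trans (proj₁ (proj₂ step₁)) (sum6 k)) loc₀

  -- For `k = 0` the exception in the block is `D 1`, which only the first triple provides; hence
  -- the bound is `1 + n`.
  k<1+n : k < 1 + n
  k<1+n = s≤s (m≤m*n k 3)

  open MiddleTriple (middleTriple loc₁ k<1+n)

  step₂ = Fills-step (1 + n) (proj₂ (proj₂ step₁))
            (free 4 loc₁ (from-yes (4 <? 10)) λ ()) nextB nextC
  loc₂ : Located (2 + n)
  loc₂ = Located-suc offset (trans (proj₁ (proj₂ step₂)) sum≡) loc₁

  step₃ = Fills-step (2 + n) (proj₂ (proj₂ step₂))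
            (nextA loc₂ (m<n⇒m<1+n k<1+n))
            (free 9 loc₂ (from-yes (9 <? 10)) λ ())
            -- The last element `10 + k * 10` of the block is read as digit 0 of block `suc k`.
            (stop (∉Ds-nonOffset {r = 0} (suc k) loc₂ (from-yes (0 <? 10)) λ ()))
  loc₃ : Located (3 + n)
  loc₃ = Located-suc seven (trans (proj₁ (proj₂ step₃)) (sum27 k)) loc₂

blockStart : ∀ k → BlockStart k
blockStart zero = record
  { located = λ ()
  -- Zero satisfies `x < 1` but is not in the empty list: the base case relies on `Fills` ranging
  -- over nonzero numbers.
  ; fills   = λ { {suc x} _ → mk⇔ (λ ()) λ { (inj₁ (s≤s ())) ; (inj₂ ()) } }
  }
blockStart (suc k) = proj₂ (block-step k (blockStart k))

-- From the values to the recurrence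

module _ (f : ℕ → ℕ)
         (f₀ : ∀ k → f (k * 3) ≡ 1 + k * 10)
         (f₁ : ∀ k → f (1 + k * 3) ≡ 4 + k * 10)
         (f₂ : ∀ k → f (2 + k * 3) ≡ 8 + k * 10) where

  -- The successive differences are 3, 4, 3 with period three, and the identity equates those at
  -- `3 + n` and `n`.
  periodic-differences : ∀ n → f (4 + n) + f n ≡ f (3 + n) + f (1 + n)
  periodic-differences n with n divMod 3
  ... | result k zero refl
    rewrite f₁ (suc k) | f₀ k | f₀ (suc k) | f₁ k = eq k
    where
    eq : ∀ k → 4 + suc k * 10 + (1 + k * 10) ≡ 1 + suc k * 10 + (4 + k * 10)
    eq = solve-∀
  ... | result k (suc zero) refl
    rewrite f₂ (suc k) | f₁ k | f₁ (suc k) | f₂ k = eq k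
    where
    eq : ∀ k → 8 + suc k * 10 + (4 + k * 10) ≡ 4 + suc k * 10 + (8 + k * 10)
    eq = solve-∀
  ... | result k (suc (suc zero)) refl
    -- Here `4 + n` is `6 + k * 3`, which starts the second block after that of `n`.
    rewrite f₀ (suc (suc k)) | f₂ k | f₂ (suc k) | f₀ (suc k) = eq k
    where
    eq : ∀ k → 1 + suc (suc k) * 10 + (8 + k * 10) ≡ 8 + suc k * 10 + (1 + suc k * 10)
    eq = solve-∀

blockA : ∀ k → BlockA k
blockA k = proj₁ (block-step k (blockStart k))

mainTheorem5 : ∀ (n : ℕ) .{{_ : NonZero n}} → A (4 + n) + A n ≡ A (3 + n) + A (1 + n)
mainTheorem5 (suc n) =
  periodic-differences (λ i → A (suc i))
    (BlockA.A₁ ∘ blockA) (BlockA.A₂ ∘ blockA) (BlockA.A₃ ∘ blockA) n
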